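{- Let $T$ be a tournament on $n$ vertices whose skew-adjacency matrix $S$ is a skew-conference matrix, that is, $S^2=(1-n)I_n$. Then $u^{+}(T)\geq n/2$.
   Context: The skew-adjacency matrix of a tournament with vertex set $\{v_1,\ldots,v_n\}$ is the $n\times n$ zero-diagonal matrix $S=[s_{ij}]$ in which $s_{ij}=1$ and $s_{ji}=-1$ if $v_i$ dominates $v_j$. A tournament is unimodular if the determinant of its skew-adjacency matrix is $1$. For a tournament $T$ on $n$ vertices, $u^{+}(T)$ is the smallest number of vertices that must be added to $T$ to obtain a unimodular tournament, i.e. the smallest $k\ge 0$ such that some unimodular tournament on $n+k$ vertices contains $T$ as a subtournament. $I_n$ denotes the $n\times n$ identity matrix.
   Formalization: The case n = 2 is excluded: every tournament on 2 vertices has S² = −I = (1−2)I and determinant 1, so u⁺(T) = 0 < 1 = n/2 and the claim as stated fails there; all other n are covered. -}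

module Defs where

open import Data.Bool.Base using (if_then_else_)
open import Data.Fin.Base using (Fin; zero; suc; toℕ; punchIn)
open import Data.Fin.Properties using (_≟_)
open import Data.Integer.Base using (ℤ; +_; 0ℤ; 1ℤ; -1ℤ; _*_; _^_; _-_; -_)
open import Data.Integer.Properties using (+-0-commutativeMonoid)
open import Algebra.Properties.CommutativeMonoid.Sum +-0-commutativeMonoid using (sum)
open import Data.Nat.Base using (ℕ; z≤n; _≤_)
import Data.Nat.Base as ℕ
open import Data.Product.Base using (∃; _×_; _,_)
open import Data.Sum.Base using (_⊎_; inj₁; inj₂)
open import Data.Vec.Functional using (Vector)
open import Function.Base using (id)
open import Level using (0ℓ)
open import Relation.Binary.Core using (Rel)
open import Relation.Binary.Definitions using (Trichotomous; tri<; tri≈; tri>)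
open import Relation.Binary.Morphism.Structures using (IsOrderMonomorphism)
open import Relation.Binary.PropositionalEquality using (_≡_; refl; sym)
open import Relation.Nullary.Decidable using (does)
open import Relation.Nullary.Negation using (contradiction)

------------------------------------------------------------------------
-- Integer matrices

Matrix : ℕ → ℕ → Set
Matrix m n = Vector (Vector ℤ n) m

infix  4 _≋_
infixl 7 _⊗_
infixr 7 _⊙_

_≋_ : ∀ {m n} → Rel (Matrix m n) 0ℓ
A ≋ B = ∀ i j → A i j ≡ B i j

_⊗_ : ∀ {m n p} → Matrix m n → Matrix n p → Matrix m p
(A ⊗ B) i j = sum (λ l → A i l * B l j)

_⊙_ : ∀ {m n} → ℤ → Matrix m n → Matrix m n
(c ⊙ A) i j = c * A i j

I : ∀ n → Matrix n n
I n i j = if does (i ≟ j) then 1ℤ else 0ℤ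

-- Cofactor expansion along the first row; the empty matrix has determinant 1.
det : ∀ {n} → Matrix n n → ℤ
det {ℕ.zero}  A = 1ℤ
det {ℕ.suc n} A =
  sum (λ j → -1ℤ ^ toℕ j * A zero j * det (λ k l → A (suc k) (punchIn j l)))

------------------------------------------------------------------------
-- Tournaments

-- Trichotomy says that exactly one of i ⇒ j, i ≡ j, j ⇒ i holds.  No
-- transitivity is required, so ⇒ is not an order in general.
record Tournament (n : ℕ) : Set₁ where
  infix 4 _⇒_
  field
    _⇒_     : Rel (Fin n) 0ℓ
    compare : Trichotomous _≡_ _⇒_

skewAdjacency : ∀ {n} → Tournament n → Matrix n n
skewAdjacency T i j with Tournament.compare T i j
... | tri< _ _ _ = 1ℤ
... | tri≈ _ _ _ = 0ℤ
... | tri> _ _ _ = -1ℤ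

Unimodular : ∀ {n} → Tournament n → Set
Unimodular T = det (skewAdjacency T) ≡ 1ℤ

-- U contains T as a subtournament, up to isomorphism: some map of vertices is
-- injective and both preserves and reflects domination.
_↪_ : ∀ {m n} → Tournament m → Tournament n → Set
T ↪ U = ∃ (IsOrderMonomorphism _≡_ _≡_ (Tournament._⇒_ T) (Tournament._⇒_ U))

UnimodularExtension : ∀ {n} → Tournament n → ℕ → Set₁
UnimodularExtension {n} T k = ∃ λ (U : Tournament (n ℕ.+ k)) → Unimodular U × T ↪ U

-- "u⁺(T) = k", with u⁺ given by its graph.
IsU⁺ : ∀ {n} → Tournament n → ℕ → Set₁
IsU⁺ T k = UnimodularExtension T k × (∀ l → UnimodularExtension T l → k ≤ l)

------------------------------------------------------------------------
-- Two vertices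

-- For n = 2 the matrix ±(0 1; -1 0) squares to (1 - 2) I and is already
-- unimodular, so u⁺ = 0 < n/2.  This is why n = 2 has to be excluded from the
-- lower bound u⁺ ≥ n/2.

private
  pattern 0F = zero
  pattern 1F = suc zero

  data Shape (S : Matrix 2 2) : Set where
    shape : ∀ c → c ≡ 1ℤ ⊎ c ≡ -1ℤ →
            S 0F 0F ≡ 0ℤ → S 0F 1F ≡ c → S 1F 0F ≡ - c → S 1F 1F ≡ 0ℤ → Shape S

  skewAdjacency-diag : ∀ {n} (T : Tournament n) i → skewAdjacency T i i ≡ 0ℤ
  skewAdjacency-diag T i with Tournament.compare T i i
  ... | tri< _ i≢i _ = contradiction refl i≢i
  ... | tri≈ _ _ _   = refl
  ... | tri> _ i≢i _ = contradiction refl i≢i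

  skewAdjacency-skew : ∀ {n} (T : Tournament n) i j →
                       skewAdjacency T j i ≡ - skewAdjacency T i j
  skewAdjacency-skew T i j with Tournament.compare T i j | Tournament.compare T j i
  ... | tri< _ _ ¬ji   | tri< ji _ _    = contradiction ji ¬ji
  ... | tri< _ i≢j _   | tri≈ _ j≡i _   = contradiction (sym j≡i) i≢j
  ... | tri< _ _ _     | tri> _ _ _     = refl
  ... | tri≈ _ i≡j _   | tri< _ j≢i _   = contradiction (sym i≡j) j≢i
  ... | tri≈ _ _ _     | tri≈ _ _ _     = refl
  ... | tri≈ _ i≡j _   | tri> _ j≢i _   = contradiction (sym i≡j) j≢i
  ... | tri> _ _ _     | tri< _ _ _     = refl
  ... | tri> _ i≢j _   | tri≈ _ j≡i _   = contradiction (sym j≡i) i≢j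
  ... | tri> ¬ij _ _   | tri> _ _ ij    = contradiction ij ¬ij

  skewAdjacency₀₁ : (T : Tournament 2) →
                    skewAdjacency T 0F 1F ≡ 1ℤ ⊎ skewAdjacency T 0F 1F ≡ -1ℤ
  skewAdjacency₀₁ T with Tournament.compare T 0F 1F
  ... | tri< _ _ _ = inj₁ refl
  ... | tri> _ _ _ = inj₂ refl

  skewAdjacency-shape : (T : Tournament 2) → Shape (skewAdjacency T)
  skewAdjacency-shape T = shape _ (skewAdjacency₀₁ T) (skewAdjacency-diag T 0F) refl
    (skewAdjacency-skew T 0F 1F) (skewAdjacency-diag T 1F)

  shape-square : ∀ S → Shape S → S ⊗ S ≋ (1ℤ - + 2) ⊙ I 2
  shape-square S (shape _ (inj₁ refl) a b c d) 0F 0F rewrite a | b | c | d = refl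
  shape-square S (shape _ (inj₁ refl) a b c d) 0F 1F rewrite a | b | c | d = refl
  shape-square S (shape _ (inj₁ refl) a b c d) 1F 0F rewrite a | b | c | d = refl
  shape-square S (shape _ (inj₁ refl) a b c d) 1F 1F rewrite a | b | c | d = refl
  shape-square S (shape _ (inj₂ refl) a b c d) 0F 0F rewrite a | b | c | d = refl
  shape-square S (shape _ (inj₂ refl) a b c d) 0F 1F rewrite a | b | c | d = refl
  shape-square S (shape _ (inj₂ refl) a b c d) 1F 0F rewrite a | b | c | d = refl
  shape-square S (shape _ (inj₂ refl) a b c d) 1F 1F rewrite a | b | c | d = refl

  shape-det : ∀ S → Shape S → det S ≡ 1ℤ
  shape-det S (shape _ (inj₁ refl) a b c d) rewrite a | b | c | d = refl
  shape-det S (shape _ (inj₂ refl) a b c d) rewrite a | b | c | d = refl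

  ↪-refl : ∀ {n} (T : Tournament n) → T ↪ T
  ↪-refl T = id , record
    { isOrderHomomorphism = record { cong = id ; mono = id }
    ; injective = id
    ; cancel    = id
    }

skewConference₂ : (T : Tournament 2) →
                  skewAdjacency T ⊗ skewAdjacency T ≋ (1ℤ - + 2) ⊙ I 2
skewConference₂ T = shape-square _ (skewAdjacency-shape T)

isU⁺₂ : (T : Tournament 2) → IsU⁺ T 0
isU⁺₂ T =
  (T , shape-det _ (skewAdjacency-shape T) , ↪-refl T) , λ _ _ → z≤n

{-# OPTIONS --safe #-}

-- Let M be the skew-adjacency matrix of a unimodular tournament on m = n + k
-- vertices containing T along f, let d ≥ 2 divide every entry of S², and let P
-- be the m × n matrix which extends a vector by zero along f.  Modulo d,
--   (x , a , b) ↦ (M P x + P a , M P S x + P b)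
-- is injective.  Indeed, on the rows outside the image of f a kernel element
-- satisfies (M P S x)ᵥ = 0, and on the rows of the image M P S x is S² x = 0.
-- So M P S x = 0 and hence S x = 0, since M is invertible.  Now (M P x)ᵥ = 0
-- outside the image, and on the image M P x is S x = 0; hence x = 0, and then
-- a = b = 0.  Counting vectors modulo d gives 3n ≤ 2(n + k).
module Submission where

open import Algebra.Properties.Semiring.Sum using (*-distribˡ-sum; *-distribʳ-sum)
open import Data.Fin.Base
  using (Fin; zero; suc; toℕ; fromℕ<; punchIn; inject₁; combine; remQuot; finToFun; funToFin)
open import Data.Fin.Induction using (<-weakInduction)
open import Data.Fin.Patterns using (0F; 1F; 2F)
open import Data.Fin.Properties
  using (_≟_; any?; punchInᵢ≢i; toℕ<n; toℕ-fromℕ<; toℕ-injective; injective⇒≤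
        ; finToFun-funToFin; funToFin-finToFin; remQuot-combine; combine-remQuot)
open import Data.Integer.Base as ℤ
  using (ℤ; +_; 0ℤ; 1ℤ; -1ℤ; _+_; _^_; _-_; -_; _%ℕ_; _/ℕ_; ∣_∣)
open import Data.Integer.DivMod using (n%ℕd<d; a≡a%ℕn+[a/ℕn]*n)
open import Data.Integer.Divisibility.Signed
  using (_∣_; divides; ∣-refl; ∣⇒∣ᵤ; ∣m∣n⇒∣m+n; ∣m+n∣m⇒∣n; ∣m⇒∣-m; ∣m⇒∣m*n; ∣n⇒∣m*n)
open import Data.Integer.Properties
  using (+-0-commutativeMonoid; +-*-semiring; +-identityʳ; *-zeroˡ; *-zeroʳ; *-identityˡ
        ; *-identityʳ; *-assoc; -1*i≡-i; neg-involutive; i-j≡0⇒i≡j; ∣i∣≡0⇒i≡0; +-injective; [+m]-[+n]≡m⊖n; ∣m⊝n∣≤m⊔n)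
open import Data.Integer.Tactic.RingSolver using (solve-∀)
open import Algebra.Properties.CommutativeMonoid.Sum +-0-commutativeMonoid
  using (sum; sum-cong-≗; sum-remove; sum-replicate-zero; ∑-distrib-+; ∑-comm)
open import Data.Nat.Base using (ℕ; zero; suc; _≤_; _<_; _*_; z≤n; s≤s; NonZero)
import Data.Nat.Base as ℕ
import Data.Nat.Divisibility as ℕ
import Data.Nat.Properties as ℕ
open import Data.Product.Base using (_×_; _,_; proj₁; proj₂; uncurry)
open import Data.Vec.Functional using (Vector; removeAt)
open import Function.Base using (_∘_)
open import Function.Definitions using (Injective)
open import Relation.Binary.Definitions using (tri<; tri≈; tri>)
open import Relation.Binary.Morphism.Structures using (IsOrderMonomorphism)
open import Relation.Binary.PropositionalEquality
  using (_≡_; _≢_; _≗_; refl; sym; trans; cong; cong₂; subst; module ≡-Reasoning)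
open import Relation.Nullary.Decidable using (yes; no)
open import Relation.Nullary.Negation using (contradiction)
open import Defs

private
  variable
    m n p q : ℕ

-- Sums

sum-zero : (t : Vector ℤ n) → (∀ i → t i ≡ 0ℤ) → sum t ≡ 0ℤ
sum-zero {n} t t≗0 = trans (sum-cong-≗ t≗0) (sum-replicate-zero n)

sum-single : (t : Vector ℤ n) (i : Fin n) → (∀ j → j ≢ i → t j ≡ 0ℤ) → sum t ≡ t i
sum-single {suc n} t i t≗0 = begin
  sum t                      ≡⟨ sum-remove t ⟩
  t i + sum (removeAt t i)   ≡⟨ cong (_+_ (t i)) (sum-zero _ (λ j → t≗0 _ (punchInᵢ≢i i j))) ⟩
  t i + 0ℤ                   ≡⟨ +-identityʳ _ ⟩
  t i                        ∎
  where open ≡-Reasoning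

sum-neg : (t : Vector ℤ n) → sum (λ i → - t i) ≡ - sum t
sum-neg t = begin
  sum (λ i → - t i)         ≡⟨ sum-cong-≗ (λ i → sym (-1*i≡-i (t i))) ⟩
  sum (λ i → -1ℤ ℤ.* t i)   ≡⟨ *-distribˡ-sum +-*-semiring -1ℤ t ⟨
  -1ℤ ℤ.* sum t             ≡⟨ -1*i≡-i _ ⟩
  - sum t                   ∎
  where open ≡-Reasoning

∣-zero : ∀ d → d ∣ 0ℤ
∣-zero d = divides 0ℤ refl

∣-sum : ∀ {d} (t : Vector ℤ n) → (∀ i → d ∣ t i) → d ∣ sum t
∣-sum {zero}  t d∣t = ∣-zero _
∣-sum {suc n} t d∣t = ∣m∣n⇒∣m+n (d∣t zero) (∣-sum (t ∘ suc) (d∣t ∘ suc))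

-- Matrices acting on vectors

infixr 7 _·_

_·_ : Matrix m n → Vector ℤ n → Vector ℤ m
(A · x) i = sum (λ l → A i l ℤ.* x l)

·-congˡ : {A B : Matrix m n} → A ≋ B → ∀ x → A · x ≗ B · x
·-congˡ A≋B x i = sum-cong-≗ (λ l → cong (ℤ._* x l) (A≋B i l))

-- Associativity of the product of a row, a matrix and a column. Stated for bare vectors, it serves
-- both matrix products and linear combinations of cofactors.
∑-assoc : (u : Vector ℤ m) (B : Matrix m n) (v : Vector ℤ n) →
          sum (λ l → sum (λ k → u k ℤ.* B k l) ℤ.* v l) ≡ sum (λ k → u k ℤ.* (B · v) k)
∑-assoc u B v = begin
  sum (λ l → sum (λ k → u k ℤ.* B k l) ℤ.* v l)
    ≡⟨ sum-cong-≗ (λ l → *-distribʳ-sum +-*-semiring (v l) (λ k → u k ℤ.* B k l)) ⟩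
  sum (λ l → sum (λ k → u k ℤ.* B k l ℤ.* v l))
    ≡⟨ ∑-comm (λ l k → u k ℤ.* B k l ℤ.* v l) ⟩
  sum (λ k → sum (λ l → u k ℤ.* B k l ℤ.* v l))
    ≡⟨ sum-cong-≗ (λ k → sum-cong-≗ (λ l → *-assoc (u k) (B k l) (v l))) ⟩
  sum (λ k → sum (λ l → u k ℤ.* (B k l ℤ.* v l)))
    ≡⟨ sum-cong-≗ (λ k → *-distribˡ-sum +-*-semiring (u k) (λ l → B k l ℤ.* v l)) ⟨
  sum (λ k → u k ℤ.* (B · v) k) ∎
  where open ≡-Reasoning

⊗-· : (A : Matrix m n) (B : Matrix n p) (x : Vector ℤ p) → (A ⊗ B) · x ≗ A · (B · x)
⊗-· A B x i = ∑-assoc (A i) B x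

·-∣ˡ : ∀ {d} {A : Matrix m n} → (∀ i j → d ∣ A i j) → ∀ x i → d ∣ (A · x) i
·-∣ˡ d∣A x i = ∣-sum _ (λ l → ∣m⇒∣m*n (x l) (d∣A i l))

·-distrib-- : (A : Matrix m n) (x y : Vector ℤ n) (i : Fin m) →
              (A · (λ l → x l - y l)) i ≡ (A · x) i - (A · y) i
·-distrib-- A x y i = begin
  sum (λ l → A i l ℤ.* (x l - y l))                     ≡⟨ sum-cong-≗ (λ l → distrib (A i l) (x l) (y l)) ⟩
  sum (λ l → A i l ℤ.* x l - A i l ℤ.* y l)             ≡⟨ ∑-distrib-+ (λ l → A i l ℤ.* x l) _ ⟩
  (A · x) i + sum (λ l → - (A i l ℤ.* y l))             ≡⟨ cong (_+_ ((A · x) i)) (sum-neg (λ l → A i l ℤ.* y l)) ⟩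
  (A · x) i - (A · y) i                                 ∎
  where
  open ≡-Reasoning
  distrib : ∀ a b c → a ℤ.* (b - c) ≡ a ℤ.* b - a ℤ.* c
  distrib = solve-∀

I-diag : (i : Fin n) → I n i i ≡ 1ℤ
I-diag i with i ≟ i
... | yes _   = refl
... | no  i≢i = contradiction refl i≢i

I-offDiag : {i j : Fin n} → i ≢ j → I n i j ≡ 0ℤ
I-offDiag {i = i} {j} i≢j with i ≟ j
... | yes i≡j = contradiction i≡j i≢j
... | no  _   = refl

-- Determinants

minor : Matrix (suc n) (suc n) → Fin (suc n) → Matrix n n
minor A j k l = A (suc k) (punchIn j l)

laplaceTerm : Matrix (suc n) (suc n) → Fin (suc n) → ℤ
laplaceTerm A j = -1ℤ ^ toℕ j ℤ.* A zero j ℤ.* det (minor A j)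

det-cong : {A B : Matrix n n} → A ≋ B → det A ≡ det B
det-cong {zero}  A≋B = refl
det-cong {suc n} A≋B = sum-cong-≗ λ j →
  cong₂ ℤ._*_ (cong (-1ℤ ^ toℕ j ℤ.*_) (A≋B zero j)) (det-cong (λ k l → A≋B (suc k) (punchIn j l)))

-- Transpositions of adjacent columns

swap : Fin n → Fin (suc n) → Fin (suc n)
swap zero    zero          = 1F
swap zero    (suc zero)    = 0F
swap zero    (suc (suc j)) = suc (suc j)
swap (suc i) zero          = zero
swap (suc i) (suc j)       = suc (swap i j)

-- `swap i` transposes the positions `inject₁ i` and `suc i`. This half of that fact lets an
-- induction over positions move a column one place to the left.
swap-inject₁ : (i : Fin n) → swap i (inject₁ i) ≡ suc i
swap-inject₁ zero    = refl
swap-inject₁ (suc i) = cong suc (swap-inject₁ i)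

sum-swap : (i : Fin n) (t : Vector ℤ (suc n)) → sum (t ∘ swap i) ≡ sum t
sum-swap zero    t = comm (t 0F) (t 1F) _
  where
  comm : ∀ a b c → b + (a + c) ≡ a + (b + c)
  comm = solve-∀
sum-swap (suc i) t = cong (_+_ (t zero)) (sum-swap i (t ∘ suc))

-- What remains of a transposition once column `j` is deleted. If `j` is not one of the two
-- exchanged columns, an adjacent transposition `i′` of the minor remains. If it is, the minor is
-- the one at `swap i j`, with its columns in their old order because the two are adjacent, and the
-- sign of the expansion flips.
data SwapPunchIn (i : Fin (suc n)) (j : Fin (suc (suc n))) : Set where
  fixes : (i′ : Fin n) → swap i j ≡ j → (∀ l → swap i (punchIn j l) ≡ punchIn j (swap i′ l)) →
          SwapPunchIn i j
  moves : -1ℤ ^ toℕ j ≡ - (-1ℤ ^ toℕ (swap i j)) → (∀ l → swap i (punchIn j l) ≡ punchIn (swap i j) l) →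
          SwapPunchIn i j

swapPunchIn : (i : Fin (suc n)) (j : Fin (suc (suc n))) → SwapPunchIn i j
swapPunchIn zero zero = moves refl λ { zero → refl ; (suc l) → refl }
swapPunchIn zero (suc zero) = moves refl λ { zero → refl ; (suc l) → refl }
swapPunchIn {suc n} zero (suc (suc j)) =
  fixes zero refl λ { zero → refl ; (suc zero) → refl ; (suc (suc l)) → refl }
swapPunchIn {suc n} (suc i) zero = fixes i refl λ l → refl
swapPunchIn {suc n} (suc i) (suc j) with swapPunchIn i j
... | fixes i′ eq comm = fixes (suc i′) (cong suc eq) λ { zero → refl ; (suc l) → cong suc (comm l) }
... | moves sign comm = moves (trans (cong (-1ℤ ℤ.*_) sign) (neg-* (-1ℤ ^ toℕ (swap i j))))
                              λ { zero → refl ; (suc l) → cong suc (comm l) }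
  where
  neg-* : ∀ a → -1ℤ ℤ.* - a ≡ - (-1ℤ ℤ.* a)
  neg-* = solve-∀

-- Term `j` of the expansion is the negative of the old term `swap i j`: by induction on the minor
-- when `j` is fixed, through the sign when it moves. Summation over all columns absorbs the
-- reindexing.
det-swap : (i : Fin n) (A : Matrix (suc n) (suc n)) → det (λ k l → A k (swap i l)) ≡ - det A
det-swap {suc n} i A = begin
  sum (laplaceTerm (λ k l → A k (swap i l)))  ≡⟨ sum-cong-≗ term ⟩
  sum (λ j → - laplaceTerm A (swap i j))      ≡⟨ sum-neg (laplaceTerm A ∘ swap i) ⟩
  - sum (laplaceTerm A ∘ swap i)              ≡⟨ cong -_ (sum-swap i (laplaceTerm A)) ⟩
  - sum (laplaceTerm A)                       ∎
  where
  open ≡-Reasoning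
  negʳ : ∀ a b → a ℤ.* - b ≡ - (a ℤ.* b)
  negʳ = solve-∀
  negˡ : ∀ a b c → - a ℤ.* b ℤ.* c ≡ - (a ℤ.* b ℤ.* c)
  negˡ = solve-∀
  term : ∀ j → laplaceTerm (λ k l → A k (swap i l)) j ≡ - laplaceTerm A (swap i j)
  term j with swapPunchIn i j
  ... | fixes i′ eq comm rewrite eq = begin
    s ℤ.* A zero j ℤ.* det (λ k l → A (suc k) (swap i (punchIn j l)))
      ≡⟨ cong (s ℤ.* A zero j ℤ.*_) (det-cong (λ k l → cong (A (suc k)) (comm l))) ⟩
    s ℤ.* A zero j ℤ.* det (λ k l → minor A j k (swap i′ l))
      ≡⟨ cong (s ℤ.* A zero j ℤ.*_) (det-swap i′ (minor A j)) ⟩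
    s ℤ.* A zero j ℤ.* - det (minor A j)
      ≡⟨ negʳ (s ℤ.* A zero j) _ ⟩
    - laplaceTerm A j ∎
    where s = -1ℤ ^ toℕ j
  ... | moves sign comm = begin
    -1ℤ ^ toℕ j ℤ.* A zero j′ ℤ.* det (λ k l → A (suc k) (swap i (punchIn j l)))
      ≡⟨ cong₂ (λ s D → s ℤ.* A zero j′ ℤ.* D) sign (det-cong (λ k l → cong (A (suc k)) (comm l))) ⟩
    - (-1ℤ ^ toℕ j′) ℤ.* A zero j′ ℤ.* det (minor A j′)
      ≡⟨ negˡ (-1ℤ ^ toℕ j′) (A zero j′) _ ⟩
    - laplaceTerm A j′ ∎
    where j′ = swap i j

-- Determinants with a repeated column

i≡-i⇒i≡0 : ∀ {i} → i ≡ - i → i ≡ 0ℤ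
i≡-i⇒i≡0 {+ zero} _ = refl

-- When the equal columns are the first two, exchanging them fixes the matrix but negates the
-- determinant. Otherwise an adjacent transposition brings the second copy one place closer to the
-- first.
det-repeated : (A : Matrix (suc n) (suc n)) (l : Fin n) → (∀ k → A k zero ≡ A k (suc l)) → det A ≡ 0ℤ
det-repeated {suc n} A l eq = <-weakInduction P base step l A eq
  where
  P : Fin (suc n) → Set
  P l = (A : Matrix (suc (suc n)) (suc (suc n))) → (∀ k → A k zero ≡ A k (suc l)) → det A ≡ 0ℤ
  base : P zero
  base A eq = i≡-i⇒i≡0 (trans (det-cong A≋A∘swap) (det-swap zero A))
    where
    A≋A∘swap : A ≋ (λ k l → A k (swap zero l))
    A≋A∘swap k zero          = eq k
    A≋A∘swap k (suc zero)    = sym (eq k)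
    A≋A∘swap k (suc (suc l)) = refl
  step : ∀ i → P (inject₁ i) → P (suc i)
  step i Pi A eq = begin
    det A                                    ≡⟨ neg-involutive (det A) ⟨
    - (- det A)                              ≡⟨ cong -_ (det-swap (suc i) A) ⟨
    - det (λ k l → A k (swap (suc i) l))     ≡⟨ cong -_ (Pi (λ k l → A k (swap (suc i) l)) eq′) ⟩
    0ℤ                                       ∎
    where
    open ≡-Reasoning
    eq′ : ∀ k → A k zero ≡ A k (suc (swap i (inject₁ i)))
    eq′ k = trans (eq k) (cong (A k ∘ suc) (sym (swap-inject₁ i)))

-- Cofactors of the first column and Cramer's rule

replaceColumn₀ : Vector ℤ (suc n) → Matrix (suc n) (suc n) → Matrix (suc n) (suc n)
replaceColumn₀ v A k zero    = v k
replaceColumn₀ v A k (suc l) = A k (suc l)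

-- The signed cofactors of the first column. The recursion follows the first row, to match the
-- expansion that defines `det`.
cofactor₀ : Matrix (suc n) (suc n) → Vector ℤ (suc n)
cofactor₀         A zero    = det (minor A zero)
cofactor₀ {suc n} A (suc k) =
  sum (λ j → -1ℤ ^ suc (toℕ j) ℤ.* A zero (suc j) ℤ.* cofactor₀ (minor A (suc j)) k)

-- In the expansion along the first row, column zero contributes the term with `v zero`. Every other
-- minor keeps the tail of `v` as its first column, so induction applies to it.
det-replaceColumn₀ : (v : Vector ℤ (suc n)) (A : Matrix (suc n) (suc n)) →
                     det (replaceColumn₀ v A) ≡ sum (λ k → cofactor₀ A k ℤ.* v k)
det-replaceColumn₀ {zero} v A = cong (λ s → s + 0ℤ) (comm (v zero))
  where
  comm : ∀ a → 1ℤ ℤ.* a ℤ.* 1ℤ ≡ 1ℤ ℤ.* a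
  comm = solve-∀
det-replaceColumn₀ {suc n} v A = cong₂ _+_ (comm (v zero) _) (begin
  sum (λ j → laplaceTerm (replaceColumn₀ v A) (suc j))
    ≡⟨ sum-cong-≗ (λ j → cong (c j ℤ.*_)
         (trans (det-cong (minor-replace j)) (det-replaceColumn₀ (v ∘ suc) (minor A (suc j))))) ⟩
  sum (λ j → c j ℤ.* sum (λ k → cofactor₀ (minor A (suc j)) k ℤ.* v (suc k)))
    ≡⟨ ∑-assoc c (λ j → cofactor₀ (minor A (suc j))) (v ∘ suc) ⟨
  sum (λ k → cofactor₀ A (suc k) ℤ.* v (suc k)) ∎)
  where
  open ≡-Reasoning
  c : Fin (suc n) → ℤ
  c j = -1ℤ ^ suc (toℕ j) ℤ.* A zero (suc j)
  comm : ∀ a b → 1ℤ ℤ.* a ℤ.* b ≡ b ℤ.* a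
  comm = solve-∀
  minor-replace : ∀ j → minor (replaceColumn₀ v A) (suc j) ≋ replaceColumn₀ (v ∘ suc) (minor A (suc j))
  minor-replace j k zero    = refl
  minor-replace j k (suc l) = refl

-- The row of cofactors times column `l` of `A` is the determinant with column `l` put in first
-- place. For `l ≢ zero` that matrix has a repeated column, so only `det A` at `zero` survives.
cramer₀ : (A : Matrix (suc n) (suc n)) (z : Vector ℤ (suc n)) →
          sum (λ k → cofactor₀ A k ℤ.* (A · z) k) ≡ det A ℤ.* z zero
cramer₀ {n} A z = begin
  sum (λ k → cofactor₀ A k ℤ.* (A · z) k)
    ≡⟨ ∑-assoc (cofactor₀ A) A z ⟨
  sum (λ l → sum (λ k → cofactor₀ A k ℤ.* A k l) ℤ.* z l)
    ≡⟨ sum-cong-≗ (λ l → cong (ℤ._* z l) (det-replaceColumn₀ (λ k → A k l) A)) ⟨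
  sum (λ l → det (A[ l ]) ℤ.* z l)
    ≡⟨ sum-single _ zero vanish ⟩
  det (A[ zero ]) ℤ.* z zero
    ≡⟨ cong (ℤ._* z zero) (det-cong A[0]≋A) ⟩
  det A ℤ.* z zero ∎
  where
  open ≡-Reasoning
  A[_] : Fin (suc n) → Matrix (suc n) (suc n)
  A[ l ] = replaceColumn₀ (λ k → A k l) A
  A[0]≋A : A[ zero ] ≋ A
  A[0]≋A k zero    = refl
  A[0]≋A k (suc l) = refl
  vanish : ∀ l → l ≢ zero → det (A[ l ]) ℤ.* z l ≡ 0ℤ
  vanish zero    0≢0 = contradiction refl 0≢0
  vanish (suc l) _   = trans (cong (ℤ._* z (suc l)) (det-repeated A[ suc l ] l (λ k → refl))) (*-zeroˡ (z (suc l)))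

-- Cramer's rule for the other columns follows by swapping them into place.
∣A·z⇒∣detA*z : ∀ {d} (A : Matrix n n) (z : Vector ℤ n) →
               (∀ k → d ∣ (A · z) k) → ∀ j → d ∣ det A ℤ.* z j
∣A·z⇒∣detA*z {suc n} {d} A z d∣Az j = <-weakInduction P base step j A z d∣Az
  where
  P : Fin (suc n) → Set
  P j = (A : Matrix (suc n) (suc n)) (z : Vector ℤ (suc n)) →
        (∀ k → d ∣ (A · z) k) → d ∣ det A ℤ.* z j
  base : P zero
  base A z d∣Az = subst (d ∣_) (cramer₀ A z) (∣-sum _ (λ k → ∣n⇒∣m*n (cofactor₀ A k) (d∣Az k)))
  negˡ : ∀ a b → - (- a ℤ.* b) ≡ a ℤ.* b
  negˡ = solve-∀
  step : ∀ i → P (inject₁ i) → P (suc i)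
  step i Pi A z d∣Az = subst (d ∣_) eq (∣m⇒∣-m (Pi A′ (z ∘ swap i) d∣A′z′))
    where
    A′ : Matrix (suc n) (suc n)
    A′ k l = A k (swap i l)
    d∣A′z′ : ∀ k → d ∣ (A′ · (z ∘ swap i)) k
    d∣A′z′ k = subst (d ∣_) (sym (sum-swap i (λ l → A k l ℤ.* z l))) (d∣Az k)
    eq : - (det A′ ℤ.* z (swap i (inject₁ i))) ≡ det A ℤ.* z (suc i)
    eq = trans (cong -_ (cong₂ ℤ._*_ (det-swap i A) (cong z (swap-inject₁ i)))) (negˡ (det A) (z (suc i)))

-- Counting vectors modulo d

residue : (d : ℕ) .{{_ : NonZero d}} → ℤ → Fin d
residue d z = fromℕ< (n%ℕd<d z d)

residue-≡⇒∣- : ∀ d .{{_ : NonZero d}} y z → residue d y ≡ residue d z → + d ∣ y - z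
residue-≡⇒∣- d y z eq = divides (y /ℕ d - z /ℕ d) (begin
  y - z
    ≡⟨ cong₂ _-_ (a≡a%ℕn+[a/ℕn]*n y d) (a≡a%ℕn+[a/ℕn]*n z d) ⟩
  (+ (y %ℕ d) + y /ℕ d ℤ.* + d) - (+ (z %ℕ d) + z /ℕ d ℤ.* + d)
    ≡⟨ cong (λ r → (+ r + y /ℕ d ℤ.* + d) - (+ (z %ℕ d) + z /ℕ d ℤ.* + d)) rem-≡ ⟩
  (+ (z %ℕ d) + y /ℕ d ℤ.* + d) - (+ (z %ℕ d) + z /ℕ d ℤ.* + d)
    ≡⟨ cancel (+ (z %ℕ d)) (y /ℕ d) (z /ℕ d) (+ d) ⟩
  (y /ℕ d - z /ℕ d) ℤ.* + d ∎)
  where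
  open ≡-Reasoning
  rem-≡ : y %ℕ d ≡ z %ℕ d
  rem-≡ = trans (sym (toℕ-fromℕ< (n%ℕd<d y d))) (trans (cong toℕ eq) (toℕ-fromℕ< (n%ℕd<d z d)))
  cancel : ∀ r a b c → (r + a ℤ.* c) - (r + b ℤ.* c) ≡ (a - b) ℤ.* c
  cancel = solve-∀

∣-<⇒≡0 : ∀ {d z} → + d ∣ z → ∣ z ∣ < d → z ≡ 0ℤ
∣-<⇒≡0 {d} {z} d∣z ∣z∣<d with ∣ z ∣ in eq | ∣⇒∣ᵤ d∣z
... | zero  | _     = ∣i∣≡0⇒i≡0 eq
... | suc _ | d∣∣z∣ = contradiction d∣∣z∣ (ℕ.>⇒∤ ∣z∣<d)

∣toℕ-toℕ⇒≡ : ∀ {d} (a b : Fin d) → + d ∣ + toℕ a - + toℕ b → a ≡ b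
∣toℕ-toℕ⇒≡ {d} a b d∣a-b = toℕ-injective (+-injective (i-j≡0⇒i≡j _ _ (∣-<⇒≡0 d∣a-b ∣a-b∣<d)))
  where
  ∣a-b∣<d : ∣ + toℕ a - + toℕ b ∣ < d
  ∣a-b∣<d = ℕ.≤-<-trans
    (subst (λ z → ∣ z ∣ ≤ toℕ a ℕ.⊔ toℕ b) (sym ([+m]-[+n]≡m⊖n (toℕ a) (toℕ b))) (∣m⊝n∣≤m⊔n (toℕ a) (toℕ b)))
    (ℕ.⊔-lub (toℕ<n a) (toℕ<n b))

-- Residue vectors with the same image under `Φ` differ by a kernel element, so `Φ` induces an
-- injection between sets of sizes `d ^ p` and `d ^ q`. Counting stands in for a rank argument
-- because the integers modulo `d` may fail to be a field.
injectiveMod⇒≤ : ∀ d → 2 ≤ d → (Φ : Vector ℤ p → Vector ℤ q) →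
                 (∀ x y i → Φ (λ l → x l - y l) i ≡ Φ x i - Φ y i) →
                 (∀ x → (∀ i → + d ∣ Φ x i) → ∀ i → + d ∣ x i) →
                 p ≤ q
injectiveMod⇒≤ {p} {q} d@(suc _) 2≤d Φ Φ-- ker = ℕ.≮⇒≥ λ q<p →
  ℕ.<⇒≱ (ℕ.^-monoʳ-< d 2≤d q<p) (injective⇒≤ h-injective)
  where
  -- The entries are the representatives from 0 to `d - 1`, so entries congruent modulo `d` are
  -- equal.
  lift : Fin (d ℕ.^ p) → Vector ℤ p
  lift s i = + toℕ (finToFun {d} {p} s i)
  h : Fin (d ℕ.^ p) → Fin (d ℕ.^ q)
  h s = funToFin (λ i → residue d (Φ (lift s) i))
  funToFin-cong : ∀ {r} {f g : Fin r → Fin d} → f ≗ g → funToFin f ≡ funToFin g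
  funToFin-cong {zero}  f≗g = refl
  funToFin-cong {suc r} f≗g = cong₂ combine (f≗g zero) (funToFin-cong (f≗g ∘ suc))
  h-injective : Injective _≡_ _≡_ h
  h-injective {s} {t} hs≡ht = begin
    s                                ≡⟨ funToFin-finToFin {p} {d} s ⟨
    funToFin (finToFun {d} {p} s)    ≡⟨ funToFin-cong (λ i → ∣toℕ-toℕ⇒≡ _ _ (ker _ d∣Φ i)) ⟩
    funToFin (finToFun {d} {p} t)    ≡⟨ funToFin-finToFin {p} {d} t ⟩
    t                                ∎
    where
    open ≡-Reasoning
    residue-≡ : ∀ i → residue d (Φ (lift s) i) ≡ residue d (Φ (lift t) i)
    residue-≡ i = trans (sym (finToFun-funToFin _ i))
                        (trans (cong (λ u → finToFun u i) hs≡ht) (finToFun-funToFin _ i))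
    d∣Φ : ∀ i → + d ∣ Φ (λ l → lift s l - lift t l) i
    d∣Φ i = subst (+ d ∣_) (sym (Φ-- (lift s) (lift t) i)) (residue-≡⇒∣- d (Φ (lift s) i) (Φ (lift t) i) (residue-≡ i))

-- Principal submatrices of unimodular matrices

-- These are the columns of the identity picked out by `f`. Multiplying by this matrix on the right
-- therefore selects columns.
extension : (Fin n → Fin m) → Matrix m n
extension f v j = I _ v (f j)

extension-image : {f : Fin n → Fin m} → Injective _≡_ _≡_ f →
                  ∀ x i → (extension f · x) (f i) ≡ x i
extension-image {f = f} f-inj x i = begin
  sum (λ j → I _ (f i) (f j) ℤ.* x j)
    ≡⟨ sum-single _ i (λ j j≢i → trans (cong (ℤ._* x j) (I-offDiag (j≢i ∘ sym ∘ f-inj))) (*-zeroˡ (x j))) ⟩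
  I _ (f i) (f i) ℤ.* x i   ≡⟨ cong (ℤ._* x i) (I-diag (f i)) ⟩
  1ℤ ℤ.* x i                ≡⟨ *-identityˡ (x i) ⟩
  x i                       ∎
  where open ≡-Reasoning

extension-outside : (f : Fin n → Fin m) → ∀ {v} → (∀ i → v ≢ f i) → ∀ x → (extension f · x) v ≡ 0ℤ
extension-outside f v∉f x =
  sum-zero _ (λ j → trans (cong (ℤ._* x j) (I-offDiag (v∉f j))) (*-zeroˡ (x j)))

⊗-extension : (A : Matrix p m) (f : Fin n → Fin m) → A ⊗ extension f ≋ (λ w j → A w (f j))
⊗-extension A f w j = begin
  sum (λ v → A w v ℤ.* I _ v (f j))
    ≡⟨ sum-single _ (f j) (λ v v≢fj → trans (cong (A w v ℤ.*_) (I-offDiag v≢fj)) (*-zeroʳ (A w v))) ⟩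
  A w (f j) ℤ.* I _ (f j) (f j)   ≡⟨ cong (A w (f j) ℤ.*_) (I-diag (f j)) ⟩
  A w (f j) ℤ.* 1ℤ                ≡⟨ *-identityʳ _ ⟩
  A w (f j)                       ∎
  where open ≡-Reasoning

module PrincipalSubmatrix
  (A : Matrix m m) (detA≡1 : det A ≡ 1ℤ) (f : Fin n → Fin m) (f-inj : Injective _≡_ _≡_ f) where

  columns : Matrix m n
  columns w j = A w (f j)

  submatrix : Matrix n n
  submatrix i j = A (f i) (f j)

  -- The border `extension f · a` vanishes outside the image of `f`, and on the image `columns · x`
  -- agrees with `submatrix · x`. Hence `d` divides `A` applied to the zero extension of `x`, and
  -- `det A ≡ 1` yields `x`. What is left on the image is `a`.
  bordered-kernel : ∀ {d} (x a : Vector ℤ n) → (∀ i → d ∣ (submatrix · x) i) →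
                    (∀ v → d ∣ (columns · x) v + (extension f · a) v) →
                    (∀ i → d ∣ x i) × (∀ i → d ∣ a i)
  bordered-kernel {d} x a d∣Bx d∣Cx+Pa = d∣x , d∣a
    where
    P : Matrix m n
    P = extension f
    d∣Cx : ∀ v → d ∣ (columns · x) v
    d∣Cx v with any? (λ i → v ≟ f i)
    ... | yes (i , refl) = d∣Bx i
    ... | no  v∉f        = subst (d ∣_)
      (trans (cong (_+_ ((columns · x) v)) (extension-outside f (λ i v≡fi → v∉f (i , v≡fi)) a))
             (+-identityʳ _))
      (d∣Cx+Pa v)
    d∣APx : ∀ v → d ∣ (A · (P · x)) v
    d∣APx v = subst (d ∣_) (trans (sym (·-congˡ (⊗-extension A f) x v)) (⊗-· A P x v)) (d∣Cx v)
    d∣x : ∀ i → d ∣ x i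
    d∣x i = subst (d ∣_)
      (trans (cong (ℤ._* (P · x) (f i)) detA≡1) (trans (*-identityˡ _) (extension-image f-inj x i)))
      (∣A·z⇒∣detA*z A (P · x) d∣APx (f i))
    d∣a : ∀ i → d ∣ a i
    d∣a i = subst (d ∣_) (extension-image f-inj a i)
      (∣m+n∣m⇒∣n (d∣Cx+Pa (f i)) (d∣Cx (f i)))

  3n≤2m : ∀ d → 2 ≤ d → (∀ i j → + d ∣ (submatrix ⊗ submatrix) i j) → 3 * n ≤ 2 * m
  3n≤2m d 2≤d d∣B² = injectiveMod⇒≤ d 2≤d Φ Φ-- ker
    where
    P : Matrix m n
    P = extension f
    -- Blocks 0, 1 and 2 hold x, a and b. The two halves of `Φ` are bordered systems sharing x.
    block : Fin 3 → Vector ℤ (3 * n) → Vector ℤ n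
    block c X i = X (combine c i)
    Ψ : Vector ℤ (3 * n) → Fin 2 → Vector ℤ m
    Ψ X zero    v = (columns · block 0F X) v + (P · block 1F X) v
    Ψ X (suc _) v = ((columns ⊗ submatrix) · block 0F X) v + (P · block 2F X) v
    Φ : Vector ℤ (3 * n) → Vector ℤ (2 * m)
    Φ X o = uncurry (Ψ X) (remQuot m o)
    sub-+ : ∀ a b c e → (a - b) + (c - e) ≡ (a + c) - (b + e)
    sub-+ = solve-∀
    Ψ-- : ∀ X Y c v → Ψ (λ l → X l - Y l) c v ≡ Ψ X c v - Ψ Y c v
    Ψ-- X Y zero    v = trans
      (cong₂ _+_ (·-distrib-- columns (block 0F X) (block 0F Y) v)
                 (·-distrib-- P (block 1F X) (block 1F Y) v))
      (sub-+ ((columns · block 0F X) v) _ _ _)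
    Ψ-- X Y (suc _) v = trans
      (cong₂ _+_ (·-distrib-- (columns ⊗ submatrix) (block 0F X) (block 0F Y) v)
                 (·-distrib-- P (block 2F X) (block 2F Y) v))
      (sub-+ (((columns ⊗ submatrix) · block 0F X) v) _ _ _)
    Φ-- : ∀ X Y o → Φ (λ l → X l - Y l) o ≡ Φ X o - Φ Y o
    Φ-- X Y o = uncurry (Ψ-- X Y) (remQuot m o)
    ker : ∀ X → (∀ o → + d ∣ Φ X o) → ∀ l → + d ∣ X l
    ker X d∣ΦX l = subst (λ l → + d ∣ X l) (combine-remQuot n l) (uncurry d∣block (remQuot {3} n l))
      where
      x = block 0F X
      d∣Ψ : ∀ c v → + d ∣ Ψ X c v
      d∣Ψ c v = subst (λ cv → + d ∣ uncurry (Ψ X) cv) (remQuot-combine c v) (d∣ΦX (combine c v))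
      d∣BBx : ∀ i → + d ∣ (submatrix · (submatrix · x)) i
      d∣BBx i = subst (+ d ∣_) (⊗-· submatrix submatrix x i) (·-∣ˡ d∣B² x i)
      -- The second half comes first: its conclusion that `d` divides `submatrix · x` is the premise
      -- needed to treat x itself.
      d∣Bx,b = bordered-kernel (submatrix · x) (block 2F X) d∣BBx
        (λ v → subst (λ t → + d ∣ t + (P · block 2F X) v) (⊗-· columns submatrix x v) (d∣Ψ 1F v))
      d∣x,a = bordered-kernel x (block 1F X) (proj₁ d∣Bx,b) (d∣Ψ 0F)
      d∣block : ∀ c i → + d ∣ block c X i
      d∣block 0F = proj₁ d∣x,a
      d∣block 1F = proj₂ d∣x,a
      d∣block 2F = proj₂ d∣Bx,b

-- Tournaments

skewAdjacency-↪ : (T : Tournament n) (U : Tournament m) ((f , _) : T ↪ U) →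
                  ∀ i j → skewAdjacency T i j ≡ skewAdjacency U (f i) (f j)
skewAdjacency-↪ T U (f , f-mono) i j with Tournament.compare T i j | Tournament.compare U (f i) (f j)
... | tri< _ _ _    | tri< _ _ _     = refl
... | tri< i⇒j _ _  | tri≈ ¬fi⇒fj _ _ = contradiction (IsOrderMonomorphism.mono f-mono i⇒j) ¬fi⇒fj
... | tri< i⇒j _ _  | tri> ¬fi⇒fj _ _ = contradiction (IsOrderMonomorphism.mono f-mono i⇒j) ¬fi⇒fj
... | tri≈ _ i≡j _  | tri< _ fi≢fj _ = contradiction (cong f i≡j) fi≢fj
... | tri≈ _ _ _    | tri≈ _ _ _     = refl
... | tri≈ _ i≡j _  | tri> _ fi≢fj _ = contradiction (cong f i≡j) fi≢fj
... | tri> _ _ j⇒i  | tri< _ _ ¬fj⇒fi = contradiction (IsOrderMonomorphism.mono f-mono j⇒i) ¬fj⇒fi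
... | tri> _ _ j⇒i  | tri≈ _ _ ¬fj⇒fi = contradiction (IsOrderMonomorphism.mono f-mono j⇒i) ¬fj⇒fi
... | tri> _ _ _    | tri> _ _ _     = refl

-- The embedding makes the matrix of `T` a principal submatrix of that of `U`, which has order
-- `n + k`. Cancelling `2 * n` in `3 * n ≤ 2 * (n + k)` leaves the bound.
n≤2k : ∀ d → 2 ≤ d → (T : Tournament n) → (∀ i j → + d ∣ (skewAdjacency T ⊗ skewAdjacency T) i j) →
       ∀ k → UnimodularExtension T k → n ≤ 2 * k
n≤2k {n} d 2≤d T d∣S² k (U , detU≡1 , T↪U@(f , f-mono)) =
  ℕ.+-cancelˡ-≤ (2 * n) n (2 * k) (begin
    2 * n ℕ.+ n         ≡⟨ ℕ.+-comm (2 * n) n ⟩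
    3 * n               ≤⟨ 3n≤2m d 2≤d d∣B² ⟩
    2 * (n ℕ.+ k)       ≡⟨ ℕ.*-distribˡ-+ 2 n k ⟩
    2 * n ℕ.+ 2 * k     ∎)
  where
  open ℕ.≤-Reasoning
  open PrincipalSubmatrix (skewAdjacency U) detU≡1 f (IsOrderMonomorphism.injective f-mono)
  d∣B² : ∀ i j → + d ∣ (submatrix ⊗ submatrix) i j
  d∣B² i j = subst (+ d ∣_)
    (sum-cong-≗ (λ l → cong₂ ℤ._*_ (skewAdjacency-↪ T U T↪U i l) (skewAdjacency-↪ T U T↪U l j)))
    (d∣S² i j)

mainTheorem5 : ∀ (n : ℕ) (T : Tournament n) → n ≢ 2 →
    skewAdjacency T ⊗ skewAdjacency T ≋ (1ℤ - + n) ⊙ I n →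
    ∀ (k : ℕ) → IsU⁺ T k → n ≤ 2 * k
mainTheorem5 zero T n≢2 S² k _ = z≤n
-- Here `1 - n` is 0, which every modulus divides; 2 is the least one allowed.
mainTheorem5 (suc zero) T n≢2 S² k (ext , _) = n≤2k 2 ℕ.≤-refl T
  (λ i j → subst (+ 2 ∣_) (sym (S² i j)) (∣m⇒∣m*n (I 1 i j) (∣-zero (+ 2)))) k ext
mainTheorem5 (suc (suc zero)) T n≢2 S² k _ = contradiction refl n≢2
-- The modulus is `d = n - 1`, at least 2 from `n = 3` on, and the square is `- d` times the
-- identity.
mainTheorem5 n@(suc d@(suc (suc _))) T n≢2 S² k (ext , _) = n≤2k d (s≤s (s≤s z≤n)) T
  (λ i j → subst (+ d ∣_) (sym (S² i j)) (∣m⇒∣m*n (I n i j) (∣m⇒∣-m ∣-refl))) k ext
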